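{- Let $k\ge2$ be an integer. For every integer $n>k-1$, $$D_k(n)+D_{k-1}(n)=D_{k-1}(n-k+1)+2A(n).$$
   Context: $A(n)$ is the number of partitions of $n$ into distinct parts. For $j\ge1$, $D_j(n)$ is the number of partitions of $n$ into non-negative parts (the part $0$ is allowed) in which the smallest part appears exactly $j$ times and no other part is repeated, with $D_j(0)=1$. -}

module Defs where

open import Data.List.Base using (List; []; _∷_; length; filter; upTo; replicate; cartesianProductWith)
open import Data.List.Membership.Propositional using (_∈_; find; lose)
open import Data.List.Membership.Propositional.Properties
  using (∈-filter⁺; ∈-filter⁻; ∈-upTo⁺; ∈-cartesianProductWith⁺; ∈-cartesianProductWith⁻)
open import Data.List.Properties using (∷-injective)
open import Data.List.Relation.Unary.All as All using (All; []; _∷_; all?)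
open import Data.List.Relation.Unary.All.Properties using (replicate⁺)
open import Data.List.Relation.Unary.AllPairs using ([]; _∷_)
open import Data.List.Relation.Unary.Any using (here; there; any?)
open import Data.List.Relation.Unary.Linked using ([]; [-]; _∷_)
open import Data.List.Relation.Unary.Unique.Propositional using (Unique)
open import Data.List.Relation.Unary.Unique.DecPropositional using (unique?)
import Data.List.Relation.Unary.Unique.Propositional.Properties as Uniqueₚ
open import Data.Nat.Base using (ℕ; zero; suc; _+_; _≤_; _<_; z≤n; s≤s)
open import Data.Nat.ListAction using (sum)
open import Data.Nat.Properties
  using (≤-totalOrder; _≟_; _≤?_; _<?_; ≤-refl; ≤-trans; ≤-reflexive; m≤m+n; m≤n+m
        ; +-mono-≤; +-monoˡ-≤; +-suc)
open import Data.List.Relation.Unary.Sorted.TotalOrder ≤-totalOrder using (Sorted; sorted?)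
open import Data.Product.Base using (∃; _×_; _,_; proj₁; proj₂)
open import Function.Base using (_∘_)
open import Function.Bundles using (_⇔_; mk⇔; Equivalence)
open import Relation.Binary.PropositionalEquality
  using (_≡_; _≢_; refl; sym; trans; cong; cong₂; subst)
open import Relation.Nullary using (Dec; yes; no; contradiction)
open import Relation.Nullary.Decidable using (_×-dec_; _→-dec_; ¬?)
open import Relation.Unary using (Pred; Decidable)
open import Level using (0ℓ)

-- A partition, i.e. a finite multiset of parts, is represented by the list of
-- its parts in weakly increasing order.  Zero parts are allowed here.

IsPartition : ℕ → Pred (List ℕ) 0ℓ
IsPartition n ps = Sorted ps × sum ps ≡ n

mult : ℕ → List ℕ → ℕ
mult p ps = length (filter (p ≟_) ps)

IsDistinctPartition : ℕ → Pred (List ℕ) 0ℓ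
IsDistinctPartition n ps = IsPartition n ps × All (0 <_) ps × Unique ps

IsSmallest : ℕ → Pred (List ℕ) 0ℓ
IsSmallest m ps = m ∈ ps × All (m ≤_) ps

IsMinRepeatedPartition : ℕ → ℕ → Pred (List ℕ) 0ℓ
IsMinRepeatedPartition j n ps =
  IsPartition n ps ×
  ∃ λ m → IsSmallest m ps × mult m ps ≡ j × (∀ {p} → p ∈ ps → p ≢ m → mult p ps ≡ 1)

isPartition? : ∀ n → Decidable (IsPartition n)
isPartition? n ps = sorted? _≤?_ ps ×-dec (sum ps ≟ n)

isDistinctPartition? : ∀ n → Decidable (IsDistinctPartition n)
isDistinctPartition? n ps = isPartition? n ps ×-dec all? (0 <?_) ps ×-dec unique? _≟_ ps

isMinRepeatedPartition? : ∀ j n → Decidable (IsMinRepeatedPartition j n)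
isMinRepeatedPartition? j n ps = isPartition? n ps ×-dec smallest?
  where
  Rest : ℕ → Set
  Rest m = All (m ≤_) ps × mult m ps ≡ j × All (λ p → p ≢ m → mult p ps ≡ 1) ps

  smallest? : Dec (∃ λ m → IsSmallest m ps × mult m ps ≡ j
                         × (∀ {p} → p ∈ ps → p ≢ m → mult p ps ≡ 1))
  smallest? with any? (λ m → all? (m ≤?_) ps ×-dec (mult m ps ≟ j)
                        ×-dec all? (λ p → ¬? (p ≟ m) →-dec (mult p ps ≟ 1)) ps) ps
  ... | yes r with m , m∈ , m≤ , mj , o ← find r = yes (m , (m∈ , m≤) , mj , All.lookup o)
  ... | no ¬r = no λ { (m , (m∈ , m≤) , mj , o) →
                       ¬r (lose {P = Rest} m∈ (m≤ , mj , All.tabulate o)) }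

-- All lists of length at most ℓ with entries in the given alphabet.  They
-- serve as a finite search space; see distinctPartitions-enumerates and
-- minRepeatedPartitions-enumerates below for the fact that the bounds chosen
-- lose no partition.

words : ℕ → List ℕ → List (List ℕ)
words zero    as = [] ∷ []
words (suc ℓ) as = [] ∷ cartesianProductWith _∷_ as (words ℓ as)

distinctPartitions : ℕ → List (List ℕ)
distinctPartitions n = filter (isDistinctPartition? n) (words n (upTo (suc n)))

minRepeatedPartitions : ℕ → ℕ → List (List ℕ)
minRepeatedPartitions j n = filter (isMinRepeatedPartition? j n) (words (j + n) (upTo (suc n)))

A : ℕ → ℕ
A n = length (distinctPartitions n)

D : ℕ → ℕ → ℕ
D j n = length (minRepeatedPartitions j n)

Enumerates : List (List ℕ) → Pred (List ℕ) 0ℓ → Set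
Enumerates xs P = Unique xs × (∀ ps → ps ∈ xs ⇔ P ps)

private
  words-unique : ∀ ℓ {as} → Unique as → Unique (words ℓ as)
  words-unique zero    u = [] ∷ []
  words-unique (suc ℓ) {as} u =
    All.tabulate nonempty ∷ Uniqueₚ.cartesianProductWith⁺ _∷_ ∷-injective u (words-unique ℓ u)
    where
    nonempty : ∀ {x} → x ∈ cartesianProductWith _∷_ as (words ℓ as) → [] ≢ x
    nonempty x∈ refl with ∈-cartesianProductWith⁻ _∷_ as (words ℓ as) x∈
    ... | _ , _ , _ , _ , ()

  ∈-words : ∀ ℓ {as ps} → length ps ≤ ℓ → All (_∈ as) ps → ps ∈ words ℓ as
  ∈-words zero    {ps = []} _ _ = here refl
  ∈-words (suc ℓ) {ps = []} _ _ = here refl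
  ∈-words (suc ℓ) {ps = p ∷ ps} (s≤s l) (p∈ ∷ ps∈) =
    there (∈-cartesianProductWith⁺ _∷_ p∈ (∈-words ℓ l ps∈))

  parts≤sum : ∀ ps → All (_≤ sum ps) ps
  parts≤sum [] = []
  parts≤sum (p ∷ ps) =
    m≤m+n p (sum ps) ∷ All.map (λ q≤ → ≤-trans q≤ (m≤n+m (sum ps) p)) (parts≤sum ps)

  length≤ : ∀ ps → length ps ≤ mult 0 ps + sum ps
  length≤ [] = z≤n
  length≤ (zero ∷ ps) = s≤s (length≤ ps)
  length≤ (suc p ∷ ps) = ≤-trans (s≤s (≤-trans (length≤ ps)
    (+-mono-≤ (≤-refl {mult 0 ps}) (m≤n+m (sum ps) p))))
    (≤-reflexive (sym (+-suc (mult 0 ps) (p + sum ps))))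

  mult0-positive : ∀ {ps} → All (0 <_) ps → mult 0 ps ≡ 0
  mult0-positive [] = refl
  mult0-positive (s≤s _ ∷ a) = mult0-positive a

  filter-enumerates : ∀ {P : Pred (List ℕ) 0ℓ} (P? : Decidable P) {ws} → Unique ws →
                      (∀ {ps} → P ps → ps ∈ ws) → Enumerates (filter P? ws) P
  filter-enumerates P? {ws} u complete =
    Uniqueₚ.filter⁺ P? u ,
    λ ps → mk⇔ (proj₂ ∘ ∈-filter⁻ P? {xs = ws}) (λ p → ∈-filter⁺ P? (complete p) p)

  in-range : ∀ {n} ps → sum ps ≡ n → All (_∈ upTo (suc n)) ps
  in-range ps refl = All.map (∈-upTo⁺ ∘ s≤s) (parts≤sum ps)

distinctPartitions-enumerates : ∀ n → Enumerates (distinctPartitions n) (IsDistinctPartition n)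
distinctPartitions-enumerates n =
  filter-enumerates (isDistinctPartition? n) (words-unique n (Uniqueₚ.upTo⁺ (suc n))) complete
  where
  complete : ∀ {ps} → IsDistinctPartition n ps → ps ∈ words n (upTo (suc n))
  complete {ps} ((_ , s) , pos , _) = ∈-words n
    (subst (length ps ≤_) (trans (cong (_+ sum ps) (mult0-positive pos)) s) (length≤ ps))
    (in-range ps s)

minRepeatedPartitions-enumerates :
  ∀ j n → Enumerates (minRepeatedPartitions j n) (IsMinRepeatedPartition j n)
minRepeatedPartitions-enumerates j n =
  filter-enumerates (isMinRepeatedPartition? j n) (words-unique (j + n) (Uniqueₚ.upTo⁺ (suc n))) complete
  where
  complete : ∀ {ps} → IsMinRepeatedPartition j n ps → ps ∈ words (j + n) (upTo (suc n))
  complete {ps} ((_ , refl) , m , (_ , m≤) , mj , _) =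
    ∈-words (j + n) (≤-trans (length≤ ps) (+-monoˡ-≤ (sum ps) (zeros m m≤ mj))) (in-range ps refl)
    where
    zeros : ∀ m → All (m ≤_) ps → mult m ps ≡ j → mult 0 ps ≤ j
    zeros zero    _  e = ≤-reflexive e
    zeros (suc m) m≤ _ =
      ≤-trans (≤-reflexive (mult0-positive (All.map (≤-trans (s≤s z≤n)) m≤))) z≤n

-- The convention D_j(0) = 1 is automatic: the partition is 0 + ⋯ + 0, j times.

D-zero : ∀ j → 1 ≤ j → D j 0 ≡ 1
D-zero j@(suc i) _ with minRepeatedPartitions j 0 | minRepeatedPartitions-enumerates j 0
... | xs | u , mem = singleton xs u (λ x∈ → only (Equivalence.to (mem _) x∈))
                                    (Equivalence.from (mem _) zeros-ok)
  where
  zs : ℕ → List ℕ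
  zs ℓ = replicate ℓ 0

  singleton : ∀ {r : List ℕ} xs → Unique xs → (∀ {x} → x ∈ xs → x ≡ r) → r ∈ xs → length xs ≡ 1
  singleton (_ ∷ []) _ _ _ = refl
  singleton (_ ∷ _ ∷ _) ((x≢y ∷ _) ∷ _) eq _ =
    contradiction (trans (eq (here refl)) (sym (eq (there (here refl))))) x≢y

  all-zero : ∀ ps → sum ps ≡ 0 → ps ≡ zs (length ps)
  all-zero [] _ = refl
  all-zero (zero ∷ ps) s = cong (0 ∷_) (all-zero ps s)

  mult-zeros : ∀ ℓ → mult 0 (zs ℓ) ≡ ℓ
  mult-zeros zero    = refl
  mult-zeros (suc ℓ) = cong suc (mult-zeros ℓ)

  ∈-zeros : ∀ ℓ {p} → p ∈ zs ℓ → p ≡ 0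
  ∈-zeros (suc ℓ) (here e)  = e
  ∈-zeros (suc ℓ) (there m) = ∈-zeros ℓ m

  sorted : ∀ ℓ → Sorted (zs ℓ)
  sorted zero          = []
  sorted (suc zero)    = [-]
  sorted (suc (suc ℓ)) = z≤n ∷ sorted (suc ℓ)

  sum-zeros : ∀ ℓ → sum (zs ℓ) ≡ 0
  sum-zeros zero    = refl
  sum-zeros (suc ℓ) = sum-zeros ℓ

  zeros-ok : IsMinRepeatedPartition j 0 (zs j)
  zeros-ok = (sorted j , sum-zeros j) , 0 , (here refl , replicate⁺ j z≤n) , mult-zeros j
           , λ p∈ p≢0 → contradiction (∈-zeros j p∈) p≢0

  only : ∀ {ps} → IsMinRepeatedPartition j 0 ps → ps ≡ zs j
  only {ps} ((_ , s) , m , (m∈ , _) , mj , _) = trans ps≡ (cong zs length≡j)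
    where
    ps≡ : ps ≡ zs (length ps)
    ps≡ = all-zero ps s
    m≡0 : m ≡ 0
    m≡0 = ∈-zeros (length ps) (subst (m ∈_) ps≡ m∈)
    length≡j : length ps ≡ j
    length≡j = trans (sym (mult-zeros (length ps)))
                     (trans (cong₂ mult (sym m≡0) (sym ps≡)) mj)

{-# OPTIONS --safe #-}
module Submission where

-- Record a partition counted by D_j(n) as (m , qs), with m the smallest part and
-- qs the increasing list of the larger parts, so that j m + sum qs = n.  If the
-- smallest part is positive, lower its copies by 1: a partition counted by
-- D_{j+1}(j + n) gives one of n with smallest part m and next part m + 1 (the one
-- copy left unchanged), and a partition counted by D_j(j + n) gives one of n in
-- which m + 1 does not occur.  Together these exhaust D_j(n); each of the two
-- families with smallest part 0 is a copy of the distinct partitions of j + n.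

open import Defs
open import Data.List.Base using (List; []; _∷_; _++_; length; map; filter; drop; replicate)
open import Data.List.Membership.Propositional using (_∈_)
open import Data.List.Membership.Propositional.Properties
  using (∈-map⁺; ∈-map⁻; ∈-++⁺ˡ; ∈-++⁺ʳ; ∈-++⁻)
open import Data.List.Membership.Propositional.Properties.WithK using (unique∧set⇒bag)
open import Data.List.Properties
  using (length-map; length-++; length-replicate; map-∘; map-id-local
        ; filter-++; filter-all; filter-none; filter-accept)
open import Data.List.Relation.Binary.BagAndSetEquality using (∼bag⇒↭)
open import Data.List.Relation.Binary.Permutation.Propositional.Properties using (↭-length)
open import Data.List.Relation.Unary.All as All using (All; []; _∷_)
import Data.List.Relation.Unary.All.Properties as Allₚ
open import Data.List.Relation.Unary.AllPairs as AllPairs using (AllPairs; []; _∷_)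
import Data.List.Relation.Unary.AllPairs.Properties as AllPairsₚ
open import Data.List.Relation.Unary.Any using (here; there)
open import Data.List.Relation.Unary.Unique.Propositional using (Unique)
import Data.List.Relation.Unary.Unique.Propositional.Properties as Uniqueₚ
open import Data.Nat.Base using (ℕ; zero; suc; _+_; _*_; _∸_; _≤_; _<_; _≥_; _>_; z≤n; s≤s)
open import Data.Nat.ListAction using (sum)
open import Data.Nat.ListAction.Properties using (sum-++)
open import Data.Nat.Properties
open import Data.Nat.Tactic.RingSolver using (solve-∀)
open import Data.List.Relation.Unary.Sorted.TotalOrder.Properties
  using (AllPairs⇒Sorted; Sorted⇒AllPairs)
open import Data.Product.Base using (∃; _×_; _,_)
open import Data.Sum.Base using (_⊎_; inj₁; inj₂; [_,_])
open import Data.Sum.Properties using (inj₁-injective; inj₂-injective)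
open import Function.Base using (_∘_)
open import Function.Bundles using (_⇔_; mk⇔; Equivalence)
open import Function.Properties.Equivalence using (⇔-isEquivalence)
open import Level using (0ℓ)
open import Relation.Binary.PropositionalEquality
  using (_≡_; _≢_; refl; sym; trans; cong; cong₂; subst; module ≡-Reasoning)
open import Relation.Binary.Structures using (IsEquivalence)
open import Relation.Nullary using (yes; no; contradiction)
open import Relation.Unary using (Pred)

private
  module ⇔ = IsEquivalence (⇔-isEquivalence {ℓ = 0ℓ})

  variable
    X Y : Set

-- Sizes of finite predicates

HasSize : Pred X 0ℓ → ℕ → Set
HasSize P n = ∃ λ xs → Unique xs × (∀ x → x ∈ xs ⇔ P x) × length xs ≡ n

-- Duplicate-free lists with the same members are permutations of each other.
HasSize-unique : {P : Pred X 0ℓ} {m n : ℕ} → HasSize P m → HasSize P n → m ≡ n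
HasSize-unique (xs , uxs , xs⇔ , refl) (ys , uys , ys⇔ , refl) =
  ↭-length (∼bag⇒↭ (unique∧set⇒bag uxs uys λ {x} → ⇔.trans (xs⇔ x) (⇔.sym (ys⇔ x))))

-- The tags keep the two families disjoint, so one family may also be added to itself, as the term
-- 2A(n) requires.
HasSize-⊎ : {P : Pred X 0ℓ} {Q : Pred Y 0ℓ} {m n : ℕ} →
            HasSize P m → HasSize Q n → HasSize [ P , Q ] (m + n)
HasSize-⊎ {P = P} {Q} (xs , uxs , xs⇔ , refl) (ys , uys , ys⇔ , refl) =
  map inj₁ xs ++ map inj₂ ys ,
  Uniqueₚ.++⁺ (Uniqueₚ.map⁺ inj₁-injective uxs) (Uniqueₚ.map⁺ inj₂-injective uys) disjoint ,
  (λ z → mk⇔ (sound z) (complete z)) ,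
  trans (length-++ (map inj₁ xs)) (cong₂ _+_ (length-map inj₁ xs) (length-map inj₂ ys))
  where
  disjoint : ∀ {z} → z ∈ map inj₁ xs × z ∈ map inj₂ ys → _
  disjoint (z∈₁ , z∈₂) with ∈-map⁻ inj₁ z∈₁ | ∈-map⁻ inj₂ z∈₂
  ... | _ , _ , refl | _ , _ , ()

  sound : ∀ z → z ∈ map inj₁ xs ++ map inj₂ ys → [ P , Q ] z
  sound z z∈ with ∈-++⁻ (map inj₁ xs) z∈
  ... | inj₁ z∈₁ with x , x∈ , refl ← ∈-map⁻ inj₁ z∈₁ = Equivalence.to (xs⇔ x) x∈
  ... | inj₂ z∈₂ with y , y∈ , refl ← ∈-map⁻ inj₂ z∈₂ = Equivalence.to (ys⇔ y) y∈

  complete : ∀ z → [ P , Q ] z → z ∈ map inj₁ xs ++ map inj₂ ys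
  complete (inj₁ x) p = ∈-++⁺ˡ (∈-map⁺ inj₁ (Equivalence.from (xs⇔ x) p))
  complete (inj₂ y) q = ∈-++⁺ʳ (map inj₁ xs) (∈-map⁺ inj₂ (Equivalence.from (ys⇔ y) q))

-- The maps are total, but they need to be mutually inverse only where `P` and `Q` hold; their
-- values elsewhere are arbitrary.
record _≅_ (P : Pred X 0ℓ) (Q : Pred Y 0ℓ) : Set where
  field
    to        : X → Y
    from      : Y → X
    to-resp   : ∀ {x} → P x → Q (to x)
    from-resp : ∀ {y} → Q y → P (from y)
    from-to   : ∀ {x} → P x → from (to x) ≡ x
    to-from   : ∀ {y} → Q y → to (from y) ≡ y

HasSize-≅ : {P : Pred X 0ℓ} {Q : Pred Y 0ℓ} {n : ℕ} → P ≅ Q → HasSize P n → HasSize Q n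
HasSize-≅ {Q = Q} P≅Q (xs , uxs , xs⇔ , refl) =
  -- A repetition in `map to xs` would survive `map from`, which gives back the duplicate-free `xs`.
  map to xs , Uniqueₚ.map⁻ (subst Unique (sym from-to-xs) uxs) ,
  (λ y → mk⇔ (sound y) (complete y)) , length-map to xs
  where
  open _≅_ P≅Q

  from-to-xs : map from (map to xs) ≡ xs
  from-to-xs = trans (sym (map-∘ xs))
    (map-id-local (All.tabulate λ {x} x∈ → from-to (Equivalence.to (xs⇔ x) x∈)))

  sound : ∀ y → y ∈ map to xs → Q y
  sound y y∈ with x , x∈ , refl ← ∈-map⁻ to y∈ = to-resp (Equivalence.to (xs⇔ x) x∈)

  complete : ∀ y → Q y → y ∈ map to xs
  complete y q = subst (_∈ map to xs) (to-from q)
    (∈-map⁺ to (Equivalence.from (xs⇔ (from y)) (from-resp q)))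

Enumerates⇒HasSize : ∀ {xs P} → Enumerates xs P → HasSize P (length xs)
Enumerates⇒HasSize {xs} (u , xs⇔) = xs , u , xs⇔ , refl

-- Multiplicities

mult-++ : ∀ p xs ys → mult p (xs ++ ys) ≡ mult p xs + mult p ys
mult-++ p xs ys = trans (cong length (filter-++ (p ≟_) xs ys)) (length-++ (filter (p ≟_) xs))

mult-absent : ∀ {p xs} → All (p ≢_) xs → mult p xs ≡ 0
mult-absent {p} p∉ = cong length (filter-none (p ≟_) p∉)

mult-replicate : ∀ p ℓ → mult p (replicate ℓ p) ≡ ℓ
mult-replicate p ℓ =
  trans (cong length (filter-all (p ≟_) (Allₚ.replicate⁺ ℓ refl))) (length-replicate ℓ)

mult-head : ∀ p xs → mult p (p ∷ xs) ≡ suc (mult p xs)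
mult-head p xs = cong length (filter-accept (p ≟_) refl)

mult-tail : ∀ p x xs → mult p xs ≤ mult p (x ∷ xs)
mult-tail p x xs = ≤-trans (m≤n+m _ _) (≤-reflexive (sym (mult-++ p (x ∷ []) xs)))

∈⇒mult>0 : ∀ {p xs} → p ∈ xs → 0 < mult p xs
∈⇒mult>0 {p} {_ ∷ xs} (here refl) = subst (0 <_) (sym (mult-head p xs)) (s≤s z≤n)
∈⇒mult>0 {p} {x ∷ xs} (there p∈)  = ≤-trans (∈⇒mult>0 p∈) (mult-tail p x xs)

Unique⇒mult≡1 : ∀ {p xs} → Unique xs → p ∈ xs → mult p xs ≡ 1
Unique⇒mult≡1 {xs = x ∷ xs} (x∉ ∷ _) (here refl) =
  trans (mult-head x xs) (cong suc (mult-absent x∉))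
Unique⇒mult≡1 {p} {x ∷ xs} (x∉ ∷ u) (there p∈) = trans (mult-++ p (x ∷ []) xs)
  (cong₂ _+_ (mult-absent ((All.lookup x∉ p∈ ∘ sym) ∷ [])) (Unique⇒mult≡1 u p∈))

-- A head that recurs in the tail has multiplicity at least 2. An upper bound, unlike an equality,
-- passes directly to the tail.
mult≤1⇒Unique : ∀ {xs} → (∀ {p} → p ∈ xs → mult p xs ≤ 1) → Unique xs
mult≤1⇒Unique {[]}     _  = []
mult≤1⇒Unique {x ∷ xs} ≤1 =
  All.tabulate (λ { x∈ refl → <-irrefl refl
    (≤-trans (s≤s (∈⇒mult>0 x∈)) (≤-trans (≤-reflexive (sym (mult-head x xs))) (≤1 (here refl)))) })
  ∷ mult≤1⇒Unique (λ {p} p∈ → ≤-trans (mult-tail p x xs) (≤1 (there p∈)))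

-- Blocks of equal parts and increasing lists

sum-replicate : ∀ ℓ m → sum (replicate ℓ m) ≡ ℓ * m
sum-replicate zero    m = refl
sum-replicate (suc ℓ) m = cong (m +_) (sum-replicate ℓ m)

drop-replicate-++ : ∀ ℓ (x : X) ys → drop ℓ (replicate ℓ x ++ ys) ≡ ys
drop-replicate-++ zero    x ys = refl
drop-replicate-++ (suc ℓ) x ys = drop-replicate-++ ℓ x ys

increasing⇒Unique : ∀ {xs} → AllPairs _<_ xs → Unique xs
increasing⇒Unique = AllPairs.map <⇒≢

sorted∧Unique⇒increasing : ∀ {xs} → AllPairs _≤_ xs → Unique xs → AllPairs _<_ xs
sorted∧Unique⇒increasing s u =
  AllPairs.zipWith (λ (x≤y , x≢y) → ≤∧≢⇒< x≤y x≢y) (s , u)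

-- By sortedness the copies of the lower bound `m` form an initial block: from the first entry other
-- than `m` onwards, every entry exceeds `m`.
sorted-split : ∀ {m ps} → AllPairs _≤_ ps → All (m ≤_) ps →
               ∃ λ qs → ps ≡ replicate (mult m ps) m ++ qs × All (m <_) qs × AllPairs _≤_ qs
sorted-split {m} {[]} _ _ = [] , refl , [] , []
sorted-split {m} {p ∷ ps} (p≤ ∷ s) (m≤p ∷ m≤) with m ≟ p
... | yes refl with qs , ps≡ , m<qs , sqs ← sorted-split s m≤ =
  qs , trans (cong (m ∷_) ps≡) (cong (λ ℓ → replicate ℓ m ++ qs) (sym (mult-head m ps))) , m<qs , sqs
... | no m≢p = p ∷ ps , cong (λ ℓ → replicate ℓ m ++ p ∷ ps) (sym (mult-absent (All.map <⇒≢ m<)))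
             , m< , p≤ ∷ s
  where
  m< : All (m <_) (p ∷ ps)
  m< = ≤∧≢⇒< m≤p m≢p ∷ All.map (≤-trans (≤∧≢⇒< m≤p m≢p)) p≤

-- Partitions as a smallest part and an increasing list of larger parts

Shape : ℕ → ℕ → Pred (ℕ × List ℕ) 0ℓ
Shape j n (m , qs) = AllPairs _<_ (m ∷ qs) × j * m + sum qs ≡ n

build : ℕ → ℕ × List ℕ → List ℕ
build j (m , qs) = replicate j m ++ qs

-- The default is harmless: a partition that has a smallest part is non-empty.
headOr0 : List ℕ → ℕ
headOr0 []      = 0
headOr0 (p ∷ _) = p

shape : ℕ → List ℕ → ℕ × List ℕ
shape j ps = headOr0 ps , drop j ps

-- The successor ensures at least one copy of `m`, so the head of the built list computes to `m`.
shape-build : ∀ j mqs → shape (suc j) (build (suc j) mqs) ≡ mqs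
shape-build j (m , qs) = cong (m ,_) (drop-replicate-++ j m qs)

sum-build : ∀ j m qs → sum (build j (m , qs)) ≡ j * m + sum qs
sum-build j m qs = trans (sum-++ (replicate j m) qs) (cong (_+ sum qs) (sum-replicate j m))

build-sound : ∀ j {n mqs} → Shape (suc j) n mqs → IsMinRepeatedPartition (suc j) n (build (suc j) mqs)
build-sound j {n} {m , qs} (m< ∷ inc , s) =
  (AllPairs⇒Sorted ≤-totalOrder sorted , trans (sum-build (suc j) m qs) s) ,
  m , (here refl , m≤) , mult-m , mult-p
  where
  m≤ : All (m ≤_) (build (suc j) (m , qs))
  m≤ = Allₚ.++⁺ (Allₚ.replicate⁺ (suc j) ≤-refl) (All.map <⇒≤ m<)

  replicate-sorted : ∀ ℓ → AllPairs _≤_ (replicate ℓ m)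
  replicate-sorted zero    = []
  replicate-sorted (suc ℓ) = Allₚ.replicate⁺ ℓ ≤-refl ∷ replicate-sorted ℓ

  sorted : AllPairs _≤_ (build (suc j) (m , qs))
  sorted = AllPairsₚ.++⁺ (replicate-sorted (suc j)) (AllPairs.map <⇒≤ inc)
    (Allₚ.replicate⁺ (suc j) (All.map <⇒≤ m<))

  mult-m : mult m (build (suc j) (m , qs)) ≡ suc j
  mult-m = trans (mult-++ m (replicate (suc j) m) qs)
    (trans (cong₂ _+_ (mult-replicate m (suc j)) (mult-absent (All.map <⇒≢ m<))) (+-identityʳ (suc j)))

  mult-p : ∀ {p} → p ∈ build (suc j) (m , qs) → p ≢ m → mult p (build (suc j) (m , qs)) ≡ 1
  mult-p {p} p∈ p≢m with ∈-++⁻ (replicate (suc j) m) p∈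
  ... | inj₁ p∈m  = contradiction (All.lookup (Allₚ.replicate⁺ {P = _≡ m} (suc j) refl) p∈m) p≢m
  ... | inj₂ p∈qs = trans (mult-++ p (replicate (suc j) m) qs)
    (cong₂ _+_ (mult-absent (Allₚ.replicate⁺ (suc j) p≢m)) (Unique⇒mult≡1 (increasing⇒Unique inc) p∈qs))

-- Matching the multiplicity equation with `refl` turns `j` into `mult m ps`, the length of the
-- block that `sorted-split` removes. The remaining parts have multiplicity at most 1, so their weak
-- order is strict.
build-complete : ∀ {j n ps} → IsMinRepeatedPartition j n ps → ∃ λ mqs → Shape j n mqs × ps ≡ build j mqs
build-complete {n = n} {ps} ((sorted , s) , m , (_ , m≤) , refl , mult-p)
  with qs , ps≡ , m< , sqs ← sorted-split (Sorted⇒AllPairs ≤-totalOrder sorted) m≤ =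
  (m , qs) ,
  (m< ∷ sorted∧Unique⇒increasing sqs (mult≤1⇒Unique mult≤1) ,
   trans (sym (sum-build (mult m ps) m qs)) (trans (cong sum (sym ps≡)) s)) ,
  ps≡
  where
  mult≤1 : ∀ {p} → p ∈ qs → mult p qs ≤ 1
  mult≤1 {p} p∈ = begin
    mult p qs                                    ≤⟨ m≤n+m _ _ ⟩
    mult p (replicate (mult m ps) m) + mult p qs ≡⟨ mult-++ p (replicate (mult m ps) m) qs ⟨
    mult p (replicate (mult m ps) m ++ qs)       ≡⟨ cong (mult p) ps≡ ⟨
    mult p ps                                    ≡⟨ mult-p p∈ps (<⇒≢ (All.lookup m< p∈) ∘ sym) ⟩
    1                                            ∎
    where
    open ≤-Reasoning
    p∈ps : p ∈ ps
    p∈ps = subst (p ∈_) (sym ps≡) (∈-++⁺ʳ (replicate (mult m ps) m) p∈)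

minRepeated≅Shape : ∀ j n → IsMinRepeatedPartition (suc j) n ≅ Shape (suc j) n
minRepeated≅Shape j n = record
  { to        = shape (suc j)
  ; from      = build (suc j)
  ; to-resp   = to-resp
  ; from-resp = build-sound j
  ; from-to   = from-to
  ; to-from   = λ {mqs} _ → shape-build j mqs
  }
  where
  to-resp : ∀ {ps} → IsMinRepeatedPartition (suc j) n ps → Shape (suc j) n (shape (suc j) ps)
  to-resp d with mqs , sh , refl ← build-complete d = subst (Shape (suc j) n) (sym (shape-build j mqs)) sh

  from-to : ∀ {ps} → IsMinRepeatedPartition (suc j) n ps → build (suc j) (shape (suc j) ps) ≡ ps
  from-to d with mqs , _ , refl ← build-complete d = cong (build (suc j)) (shape-build j mqs)

-- Zero copies of the part 0 add nothing to the sum, while the virtual head 0 forces the parts in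
-- `qs` to be positive.
IncreasingPositive : ℕ → Pred (List ℕ) 0ℓ
IncreasingPositive n qs = Shape 0 n (0 , qs)

distinct≅IncreasingPositive : ∀ n → IsDistinctPartition n ≅ IncreasingPositive n
distinct≅IncreasingPositive n = record
  { to        = λ qs → qs
  ; from      = λ qs → qs
  ; to-resp   = λ ((sorted , s) , 0< , u) →
      0< ∷ sorted∧Unique⇒increasing (Sorted⇒AllPairs ≤-totalOrder sorted) u , s
  ; from-resp = λ { (0< ∷ inc , s) →
      (AllPairs⇒Sorted ≤-totalOrder (AllPairs.map <⇒≤ inc) , s) , 0< , increasing⇒Unique inc }
  ; from-to   = λ _ → refl
  ; to-from   = λ _ → refl
  }

-- Lowering the smallest part

-- Of the `suc j` copies of `suc m`, `j` are lowered, which costs `j` in total; the last one joins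
-- the larger parts.
lower-sum⁺ : ∀ j m s → suc j * suc m + s ≡ j + (j * m + (suc m + s))
lower-sum⁺ = solve-∀

lower-sum : ∀ j m s → j * suc m + s ≡ j + (j * m + s)
lower-sum = solve-∀

-- The two sides of the recurrence at `j + n`, as disjoint unions.
Source Target : ℕ → ℕ → Pred _ 0ℓ
Source j n = [ Shape (suc j) (j + n) , Shape j (j + n) ]
Target j n = [ Shape j n , [ IncreasingPositive (j + n) , IncreasingPositive (j + n) ] ]

lower : (ℕ × List ℕ) ⊎ (ℕ × List ℕ) → (ℕ × List ℕ) ⊎ (List ℕ ⊎ List ℕ)
lower (inj₁ (zero  , qs)) = inj₂ (inj₁ qs)
lower (inj₁ (suc m , qs)) = inj₁ (m , suc m ∷ qs)
lower (inj₂ (zero  , qs)) = inj₂ (inj₂ qs)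
lower (inj₂ (suc m , qs)) = inj₁ (m , qs)

-- The least larger part reveals the origin: if it is `suc m`, it is the copy left unchanged by
-- `lower`; otherwise, in an increasing list, `suc m` does not occur at all and every copy was
-- lowered.
raise : (ℕ × List ℕ) ⊎ (List ℕ ⊎ List ℕ) → (ℕ × List ℕ) ⊎ (ℕ × List ℕ)
raise (inj₁ (m , [])) = inj₂ (suc m , [])
raise (inj₁ (m , q ∷ qs)) with q ≟ suc m
... | yes _ = inj₁ (suc m , qs)
... | no  _ = inj₂ (suc m , q ∷ qs)
raise (inj₂ (inj₁ qs)) = inj₁ (0 , qs)
raise (inj₂ (inj₂ qs)) = inj₂ (0 , qs)

Source≅Target : ∀ j n → Source j n ≅ Target j n
Source≅Target j n = record
  { to        = lower
  ; from      = raise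
  ; to-resp   = λ {z} → lower-resp z
  ; from-resp = λ {z} → raise-resp z
  ; from-to   = λ {z} → raise-lower z
  ; to-from   = λ {z} → lower-raise z
  }
  where
  lower-resp : ∀ z → Source j n z → Target j n (lower z)
  lower-resp (inj₁ (zero , qs)) (inc , s) =
    -- `suc j * 0` computes to `j * 0`, so both families with smallest part 0 are treated alike.
    inc , trans (cong (_+ sum qs) (sym (*-zeroʳ j))) s
  lower-resp (inj₁ (suc m , qs)) (m< ∷ inc , s) =
    (n<1+n m ∷ All.map (<-trans (n<1+n m)) m<) ∷ m< ∷ inc ,
    +-cancelˡ-≡ j _ _ (trans (sym (lower-sum⁺ j m (sum qs))) s)
  lower-resp (inj₂ (zero , qs)) (inc , s) =
    inc , trans (cong (_+ sum qs) (sym (*-zeroʳ j))) s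
  lower-resp (inj₂ (suc m , qs)) (m< ∷ inc , s) =
    All.map (<-trans (n<1+n m)) m< ∷ inc ,
    +-cancelˡ-≡ j _ _ (trans (sym (lower-sum j m (sum qs))) s)

  raise-resp : ∀ z → Target j n z → Source j n (raise z)
  raise-resp (inj₁ (m , [])) (_ , s) =
    [] ∷ [] , trans (lower-sum j m 0) (cong (j +_) s)
  raise-resp (inj₁ (m , q ∷ qs)) ((m<q ∷ _) ∷ q< ∷ inc , s) with q ≟ suc m
  ... | yes refl = q< ∷ inc , trans (lower-sum⁺ j m (sum qs)) (cong (j +_) s)
  -- `m < q` means `suc m ≤ q`; excluding equality leaves room to raise `m` while staying strictly
  -- below `q`.
  ... | no q≢    = (1+m<q ∷ All.map (<-trans 1+m<q) q<) ∷ q< ∷ inc ,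
                   trans (lower-sum j m (q + sum qs)) (cong (j +_) s)
    where
    1+m<q : suc m < q
    1+m<q = ≤∧≢⇒< m<q (q≢ ∘ sym)
  raise-resp (inj₂ (inj₁ qs)) (inc , s) =
    inc , trans (cong (_+ sum qs) (*-zeroʳ j)) s
  raise-resp (inj₂ (inj₂ qs)) (inc , s) =
    inc , trans (cong (_+ sum qs) (*-zeroʳ j)) s

  raise-lower : ∀ z → Source j n z → raise (lower z) ≡ z
  raise-lower (inj₁ (zero , qs)) _ = refl
  raise-lower (inj₁ (suc m , qs)) _ with suc m ≟ suc m
  ... | yes _ = refl
  ... | no ≢  = contradiction refl ≢
  raise-lower (inj₂ (zero , qs)) _ = refl
  raise-lower (inj₂ (suc m , [])) _ = refl
  raise-lower (inj₂ (suc m , q ∷ qs)) ((1+m<q ∷ _) ∷ _ , _) with q ≟ suc m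
  -- Here `suc m` is itself the smallest part before lowering, so the next part cannot equal it.
  ... | yes refl = contradiction 1+m<q (<-irrefl refl)
  ... | no _     = refl

  lower-raise : ∀ z → Target j n z → lower (raise z) ≡ z
  lower-raise (inj₁ (m , [])) _ = refl
  lower-raise (inj₁ (m , q ∷ qs)) _ with q ≟ suc m
  ... | yes refl = refl
  ... | no _     = refl
  lower-raise (inj₂ (inj₁ qs)) _ = refl
  lower-raise (inj₂ (inj₂ qs)) _ = refl

-- Counting both sides of the recurrence

D-HasSize : ∀ j n → HasSize (Shape (suc j) n) (D (suc j) n)
D-HasSize j n = HasSize-≅ (minRepeated≅Shape j n)
  (Enumerates⇒HasSize (minRepeatedPartitions-enumerates (suc j) n))

A-HasSize : ∀ n → HasSize (IncreasingPositive n) (A n)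
A-HasSize n = HasSize-≅ (distinct≅IncreasingPositive n)
  (Enumerates⇒HasSize (distinctPartitions-enumerates n))

D-recurrence : ∀ i n → let j = suc i in
               D (suc j) (j + n) + D j (j + n) ≡ D j n + 2 * A (j + n)
D-recurrence i n = trans
  (HasSize-unique
    (HasSize-≅ (Source≅Target j n) (HasSize-⊎ (D-HasSize j (j + n)) (D-HasSize i (j + n))))
    (HasSize-⊎ (D-HasSize i n) (HasSize-⊎ (A-HasSize (j + n)) (A-HasSize (j + n)))))
  -- `2 * a` computes to `a + (a + 0)`.
  (cong (λ a → D j n + (A (j + n) + a)) (sym (+-identityʳ (A (j + n)))))
  where
  j : ℕ
  j = suc i

theorem12 : ∀ (k : ℕ) → k ≥ 2 → ∀ (n : ℕ) → n > k ∸ 1 →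
    D k n + D (k ∸ 1) n ≡ D (k ∸ 1) (n ∸ k + 1) + 2 * A n
theorem12 (suc j@(suc i)) (s≤s (s≤s _)) n n>j = begin
  D (suc j) n + D j n                ≡⟨ cong (λ x → D (suc j) x + D j x) n≡ ⟩
  D (suc j) (j + n′) + D j (j + n′)  ≡⟨ D-recurrence i n′ ⟩
  D j n′ + 2 * A (j + n′)            ≡⟨ cong (λ x → D j n′ + 2 * A x) n≡ ⟨
  D j n′ + 2 * A n                   ∎
  where
  open ≡-Reasoning
  n′ : ℕ
  -- The hypothesis `n > j` is `suc j ≤ n`, so the truncated subtraction is exact and `n′` is n - j.
  n′ = n ∸ suc j + 1

  n≡ : n ≡ j + n′
  n≡ = begin
    n                       ≡⟨ m+[n∸m]≡n n>j ⟨
    suc j + (n ∸ suc j)     ≡⟨ +-suc j (n ∸ suc j) ⟨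
    j + suc (n ∸ suc j)     ≡⟨ cong (j +_) (+-comm 1 (n ∸ suc j)) ⟩
    j + n′                  ∎
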